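{- Let $G$ be a simple connected graph with $n\ge 2$ vertices, diameter $d$ and Wiener index $W(G)$. Then $$DLS(G)\geq \frac{2n+d^2-2d+1}{2}-\frac{2W(G)}{n-1}.$$
   Context: All graphs are finite, simple and connected. For a connected graph $G$ on vertices $v_1,\dots,v_n$, $d_{uv}$ denotes the distance (length of a shortest path) between $u$ and $v$, and $D(G)=(d_{uv})$ is the distance matrix. The diameter is the maximum distance between two vertices. The transmission of a vertex $v$ is $Tr(v)=\sum_{u\in V(G)}d_{uv}$. The Wiener index is $W(G)=\frac12\sum_{u,v\in V(G)}d_{uv}$ (the sum of distances over unordered pairs of vertices). The distance Laplacian matrix is $D^L(G)=\mathrm{diag}(Tr(v_1),\dots,Tr(v_n))-D(G)$; it is positive semidefinite, and its eigenvalues, with multiplicity, are written $\partial_1^L(G)\ge \partial_2^L(G)\ge\dots\ge\partial_n^L(G)=0$. The distance Laplacian spread is $DLS(G)=\partial_1^L(G)-\partial_{n-1}^L(G)$. -}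

module Defs where

open import Level using (Level; 0ℓ) renaming (suc to lsuc; _⊔_ to _⊔ˡ_)
open import Algebra.Bundles using (CommutativeRing)
open import Algebra.Core using (Op₁; Op₂)
open import Algebra.Structures using (IsCommutativeRing)
import Algebra.Definitions.RawMonoid as RawMonoid
open import Data.Bool.Base using (if_then_else_)
open import Data.Fin.Base as Fin using (Fin; zero; suc; fromℕ; inject₁)
import Data.Fin.Properties as Fin
open import Data.Nat.Base as ℕ using (ℕ; zero; suc; _⊔_; z≤n; s≤s)
import Data.Nat.Properties as ℕ
open import Data.Product.Base using (∃; _×_; _,_; proj₁; proj₂)
open import Data.Vec.Base using (count; tabulate)
open import Data.Vec.Functional using (Vector; foldr)
open import Function.Base using (_∘_)
open import Relation.Binary.Core using (Rel)
open import Relation.Binary.Definitions using (Irreflexive; Symmetric)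
import Relation.Binary.Definitions as Binary
open import Relation.Binary.PropositionalEquality.Core using (_≡_; refl)
open import Relation.Binary.Structures using (IsDecTotalOrder)
open import Relation.Nullary.Decidable.Core using (yes; no; does; map′; _×-dec_)
open import Relation.Nullary.Negation.Core using (¬_; contradiction)
open import Relation.Unary using (Pred; Decidable; _∈_)

private
  variable
    n : ℕ

------------------------------------------------------------------------
-- Graphs on the vertex set Fin n

record SimpleGraph (n : ℕ) : Set₁ where
  infix 4 _~_ _~?_
  field
    _~_      : Rel (Fin n) 0ℓ
    _~?_     : Binary.Decidable _~_
    ~-sym    : Symmetric _~_
    ~-irrefl : Irreflexive _≡_ _~_

  data Walk : Fin n → Fin n → ℕ → Set where
    []  : ∀ {u} → Walk u u 0
    _∷_ : ∀ {u w v k} → u ~ w → Walk w v k → Walk u v (suc k)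

  walk? : ∀ u v → Decidable (Walk u v)
  walk? u v zero    = map′ (λ { refl → [] }) (λ { [] → refl }) (u Fin.≟ v)
  walk? u v (suc k) =
    map′ (λ { (_ , e , p) → e ∷ p }) (λ { (e ∷ p) → _ , e , p })
         (Fin.any? λ w → (u ~? w) ×-dec walk? w v k)

least : {P : Pred ℕ 0ℓ} → Decidable P → ∀ k → P k →
        ∃ λ m → P m × (∀ j → P j → m ℕ.≤ j)
least P? zero    p = 0 , p , λ _ _ → z≤n
least P? (suc k) p with P? 0
... | yes p₀ = 0 , p₀ , λ _ _ → z≤n
... | no ¬p₀ with least (P? ∘ suc) k p
...   | m , pₘ , minimal = suc m , pₘ , λ
  { zero    p₀ → contradiction p₀ ¬p₀
  ; (suc j) pⱼ → s≤s (minimal j pⱼ)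
  }

record ConnectedGraph (n : ℕ) : Set₁ where
  field
    simpleGraph : SimpleGraph n

  open SimpleGraph simpleGraph public

  field
    connected : ∀ u v → ∃ (Walk u v)

  -- A walk of minimum length repeats no vertex, so minimising over walks
  -- gives the length of a shortest path.
  dist : Fin n → Fin n → ℕ
  dist u v = proj₁ (least (walk? u v) (proj₁ (connected u v)) (proj₂ (connected u v)))

  diameter : ℕ
  diameter = foldr _⊔_ 0 λ u → foldr _⊔_ 0 λ v → dist u v

  transmission : Fin n → ℕ
  transmission v = RawMonoid.sum ℕ.+-0-rawMonoid λ u → dist u v

------------------------------------------------------------------------
-- Ordered fields

-- The scalars and eigenvalues live in a totally ordered field, of which
-- (classically) the real numbers are an instance.

record OrderedField c ℓ₁ ℓ₂ : Set (lsuc (c ⊔ˡ ℓ₁ ⊔ˡ ℓ₂)) where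
  infix  9 _⁻¹
  infix  8 -_
  infixl 7 _*_ _/_
  infixl 6 _+_
  infix  4 _≈_ _≤_
  field
    Carrier           : Set c
    _≈_               : Rel Carrier ℓ₁
    _≤_               : Rel Carrier ℓ₂
    _+_ _*_           : Op₂ Carrier
    -_                : Op₁ Carrier
    0# 1#             : Carrier
    -- Total for convenience; the value at 0# is unconstrained.
    _⁻¹               : Op₁ Carrier
    isCommutativeRing : IsCommutativeRing _≈_ _+_ _*_ -_ 0# 1#
    isDecTotalOrder   : IsDecTotalOrder _≈_ _≤_
    0≉1               : ¬ (0# ≈ 1#)
    ⁻¹-inverseʳ       : ∀ x → ¬ (x ≈ 0#) → x * x ⁻¹ ≈ 1#
    +-monoˡ-≤         : ∀ {x y} z → x ≤ y → x + z ≤ y + z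
    *-nonNeg          : ∀ {x y} → 0# ≤ x → 0# ≤ y → 0# ≤ x * y

  commutativeRing : CommutativeRing c ℓ₁
  commutativeRing = record { isCommutativeRing = isCommutativeRing }

  open CommutativeRing commutativeRing public
    using (setoid; semiring; +-rawMonoid; +-commutativeMonoid; _-_)
  open IsDecTotalOrder isDecTotalOrder public using (_≟_; _≤?_)
  open RawMonoid +-rawMonoid public using (sum)

  _/_ : Op₂ Carrier
  x / y = x * y ⁻¹

  ⟦_⟧ : ℕ → Carrier
  ⟦ m ⟧ = RawMonoid._×_ +-rawMonoid m 1#

------------------------------------------------------------------------
-- Linear algebra over an ordered field

module LinearAlgebra {c ℓ₁ ℓ₂} (F : OrderedField c ℓ₁ ℓ₂) where
  open OrderedField F

  Matrix : ℕ → Set c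
  Matrix n = Fin n → Fin n → Carrier

  diag : Vector Carrier n → Matrix n
  diag x i j = if does (i Fin.≟ j) then x i else 0#

  combination : ∀ {k} → Vector Carrier k → Vector (Vector Carrier n) k → Vector Carrier n
  combination a b i = sum λ j → a j * b j i

  LinearlyIndependent : ∀ {k} → Vector (Vector Carrier n) k → Set (c ⊔ˡ ℓ₁)
  LinearlyIndependent b = ∀ a → (∀ i → combination a b i ≈ 0#) → ∀ j → a j ≈ 0#

  record Basis {ℓ} (V : Pred (Vector Carrier n) ℓ) (k : ℕ) : Set (c ⊔ˡ ℓ₁ ⊔ˡ ℓ) where
    field
      vectors     : Vector (Vector Carrier n) k
      inSubspace  : ∀ j → vectors j ∈ V
      independent : LinearlyIndependent vectors
      spanning    : ∀ x → x ∈ V → ∃ λ a → ∀ i → x i ≈ combination a vectors i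

  Eigenspace : Matrix n → Carrier → Pred (Vector Carrier n) ℓ₁
  Eigenspace M μ x = ∀ i → sum (λ j → M i j * x j) ≈ μ * x i

  multiplicity : Carrier → Vector Carrier n → ℕ
  multiplicity μ θ = count (μ ≟_) (tabulate θ)

  -- θ lists the eigenvalues of M in non-increasing order, each repeated
  -- according to its multiplicity, i.e. the dimension of its eigenspace.
  -- (A scalar that is not an eigenvalue has a zero-dimensional eigenspace,
  -- so it does not occur in θ.)
  record Eigenvalues (M : Matrix n) (θ : Vector Carrier n) : Set (c ⊔ˡ ℓ₁ ⊔ˡ ℓ₂) where
    field
      decreasing : ∀ i j → i Fin.≤ j → θ j ≤ θ i
      dimension  : ∀ μ → Basis (Eigenspace M μ) (multiplicity μ θ)

------------------------------------------------------------------------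
-- The distance Laplacian

module DistanceLaplacian {c ℓ₁ ℓ₂} (F : OrderedField c ℓ₁ ℓ₂) where
  open OrderedField F
  open LinearAlgebra F public

  module _ (G : ConnectedGraph n) where
    open ConnectedGraph G

    wiener : Carrier
    wiener = sum (λ u → sum λ v → ⟦ dist u v ⟧) / ⟦ 2 ⟧

    distanceMatrix : Matrix n
    distanceMatrix u v = ⟦ dist u v ⟧

    distanceLaplacian : Matrix n
    distanceLaplacian u v = diag (λ w → ⟦ transmission w ⟧) u v - distanceMatrix u v

  -- First minus next-to-last entry, θ₁ − θₙ₋₁.
  spread : 2 ℕ.≤ n → Vector Carrier n → Carrier
  spread {suc (suc m)} (s≤s (s≤s _)) θ = θ zero - θ (inject₁ (fromℕ m))

-- Splitting one eigenvector off an eigenspace per entry of ∂ (a Gram–Schmidt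
-- step without normalisation, so no square roots are needed) gives n pairwise
-- orthogonal eigenvectors, hence δ = ∑ eᵢ eᵢᵀ / |eᵢ|² and
-- Dᴸ = ∑ ∂ᵢ eᵢ eᵢᵀ / |eᵢ|².
--
-- The trace is ∑ ∂ᵢ = 2W, and every ∂ᵢ ≥ 0 since Dᴸ is positive semidefinite,
-- so (n - 1) ∂ₙ₋₁ ≤ 2W.
--
-- Testing Dᴸ on δ u - δ v, where d = dist u v is the diameter, gives
-- Tr u + Tr v + 2d ≤ 2 ∂₁.  Finally 2n + d² + 1 ≤ Tr u + Tr v + 4d: for d ≥ 2
-- because nd ≤ Tr u + Tr v and d < n, for d = 1 because n - 1 ≤ Tr.

module Submission where

open import Defs
open import Algebra.Bundles using (CommutativeRing)
import Algebra.Properties.AbelianGroup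
import Algebra.Properties.CommutativeMonoid.Sum
import Algebra.Properties.Ring
import Algebra.Properties.Semiring.Mult
import Algebra.Properties.Semiring.Sum
import Algebra.Solver.Ring
open import Algebra.Solver.Ring.AlmostCommutativeRing
  using (fromCommutativeRing; _-Raw-AlmostCommutative⟶_; Induced-equivalence)
open import Data.Fin.Base as Fin using (Fin; zero; suc; toℕ; fromℕ; inject₁)
import Data.Fin.Properties as Fin
open import Data.Integer.Base as ℤ using (ℤ; +_; -[1+_])
import Data.Integer.Properties as ℤ
import Data.Maybe.Base as Maybe
open import Data.Nat.Base as Nat using (ℕ; zero; suc)
import Data.Nat.Properties as Nat
open import Data.Nat.Tactic.RingSolver using (solve-∀)
open import Data.Product.Base using (∃; _×_; _,_; proj₁; proj₂)
open import Data.Sum.Base using (inj₁; inj₂)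
open import Data.Vec.Functional using (Vector; foldr)
open import Function.Base using (_∘_)
open import Level using () renaming (_⊔_ to _⊔ˡ_)
open import Relation.Binary.Bundles using (Poset)
open import Relation.Binary.Definitions using (WeaklyDecidable)
open import Relation.Binary.PropositionalEquality as ≡ using (_≡_; _≢_)
import Relation.Binary.Reasoning.PartialOrder
import Relation.Binary.Reasoning.Setoid
open import Relation.Binary.Structures using (IsDecTotalOrder)
open import Relation.Nullary.Decidable using (yes; no; dec⇒maybe; dec-true; dec-false)
open import Relation.Nullary.Negation.Core using (¬_; contradiction)

-- Over an arbitrary ordered field a symmetric matrix may lack eigenvalues, so the list of
-- eigenvalues is a hypothesis, and the eigenvectors are drawn from its dimension data: each entry
-- of the list accounts for one vector of the corresponding eigenspace. The step from n orthogonal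
-- vectors to the formula for δ is a count of traces: n rank-one projections of trace 1 against the
-- trace n of δ.
--
-- The numerator comes from the two cases for d. If d ≥ 2, then nd = 2n + n(d - 2) and n ≥ d - 2
-- give Tr u + Tr v ≥ 2n + (d - 2)², which is 2n + d² - 4d + 4. If d = 1, the bound 2n - 2 equals 2n
-- + d² - 4d + 1, so this case fixes the constant 1. The two off-diagonal entries add 2d, turning
-- -4d into -2d. The denominator 2 is the squared length of δ u - δ v.

private
  variable
    m n k : ℕ

-- Ring normalisation with integer coefficients.

module IntegerCoefficientSolver {c ℓ} (R : CommutativeRing c ℓ) where
  open CommutativeRing R
  open Algebra.Properties.Ring ring
  open Algebra.Properties.AbelianGroup +-abelianGroup using (⁻¹-∙-comm)
  open Algebra.Properties.Semiring.Mult semiring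
    using (×-homo-+; ×1-homo-*) renaming (_×_ to _×ⁿ_)
  open Relation.Binary.Reasoning.Setoid setoid

  -- Agrees by definition with `⟦_⟧` of `OrderedField`, so that `con (+ k)` in a solver goal is
  -- literally `⟦ k ⟧`.
  ⟦_⟧ⁿ : ℕ → Carrier
  ⟦ n ⟧ⁿ = n ×ⁿ 1#

  ⟦_⟧ᶻ : ℤ → Carrier
  ⟦ + n ⟧ᶻ      = ⟦ n ⟧ⁿ
  ⟦ -[1+ n ] ⟧ᶻ = - ⟦ suc n ⟧ⁿ

  cancel-suc : ∀ x y → (1# + x) - (1# + y) ≈ x - y
  cancel-suc x y = begin
    (1# + x) - (1# + y)      ≈⟨ +-cong (+-comm 1# x) (sym (⁻¹-∙-comm 1# y)) ⟩
    (x + 1#) + (- 1# - y)    ≈⟨ +-assoc x 1# _ ⟩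
    x + (1# + (- 1# - y))    ≈⟨ +-congˡ (+-assoc 1# _ _) ⟨
    x + ((1# - 1#) - y)      ≈⟨ +-congˡ (+-congʳ (-‿inverseʳ 1#)) ⟩
    x + (0# - y)             ≈⟨ +-congˡ (+-identityˡ _) ⟩
    x - y                    ∎

  ⊖-homo : ∀ m n → ⟦ m ℤ.⊖ n ⟧ᶻ ≈ ⟦ m ⟧ⁿ - ⟦ n ⟧ⁿ
  ⊖-homo zero    zero    = sym (-‿inverseʳ 0#)
  ⊖-homo zero    (suc n) = sym (+-identityˡ _)
  ⊖-homo (suc m) zero    = sym (trans (+-congˡ -0#≈0#) (+-identityʳ _))
  ⊖-homo (suc m) (suc n) = begin
    ⟦ suc m ℤ.⊖ suc n ⟧ᶻ     ≡⟨ ≡.cong ⟦_⟧ᶻ (ℤ.[1+m]⊖[1+n]≡m⊖n m n) ⟩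
    ⟦ m ℤ.⊖ n ⟧ᶻ             ≈⟨ ⊖-homo m n ⟩
    ⟦ m ⟧ⁿ - ⟦ n ⟧ⁿ          ≈⟨ cancel-suc _ _ ⟨
    ⟦ suc m ⟧ⁿ - ⟦ suc n ⟧ⁿ  ∎

  neg-homo : ∀ i → ⟦ ℤ.- i ⟧ᶻ ≈ - ⟦ i ⟧ᶻ
  neg-homo (+ zero)  = sym -0#≈0#
  neg-homo (+ suc n) = refl
  neg-homo -[1+ n ]  = sym (-‿involutive _)

  +-homo : ∀ i j → ⟦ i ℤ.+ j ⟧ᶻ ≈ ⟦ i ⟧ᶻ + ⟦ j ⟧ᶻ
  +-homo (+ m)    (+ n)    = ×-homo-+ 1# m n
  +-homo (+ m)    -[1+ n ] = ⊖-homo m (suc n)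
  +-homo -[1+ m ] (+ n)    = trans (⊖-homo n (suc m)) (+-comm _ _)
  +-homo -[1+ m ] -[1+ n ] = begin
    - ⟦ suc (suc (m Nat.+ n)) ⟧ⁿ    ≡⟨ ≡.cong (λ k → - ⟦ suc k ⟧ⁿ) (Nat.+-suc m n) ⟨
    - ⟦ suc m Nat.+ suc n ⟧ⁿ        ≈⟨ -‿cong (×-homo-+ 1# (suc m) (suc n)) ⟩
    - (⟦ suc m ⟧ⁿ + ⟦ suc n ⟧ⁿ)   ≈⟨ ⁻¹-∙-comm _ _ ⟨
    - ⟦ suc m ⟧ⁿ - ⟦ suc n ⟧ⁿ     ∎

  pos-*-homo : ∀ m n → ⟦ (+ m) ℤ.* (+ n) ⟧ᶻ ≈ ⟦ m ⟧ⁿ * ⟦ n ⟧ⁿ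
  pos-*-homo m n = begin
    ⟦ (+ m) ℤ.* (+ n) ⟧ᶻ  ≡⟨ ≡.cong ⟦_⟧ᶻ (ℤ.pos-* m n) ⟨
    ⟦ m Nat.* n ⟧ⁿ          ≈⟨ ×1-homo-* m n ⟩
    ⟦ m ⟧ⁿ * ⟦ n ⟧ⁿ       ∎

  posˡ-*-homo : ∀ m j → ⟦ (+ m) ℤ.* j ⟧ᶻ ≈ ⟦ m ⟧ⁿ * ⟦ j ⟧ᶻ
  posˡ-*-homo m (+ n)    = pos-*-homo m n
  posˡ-*-homo m -[1+ n ] = begin
    ⟦ (+ m) ℤ.* -[1+ n ] ⟧ᶻ          ≡⟨ ≡.cong ⟦_⟧ᶻ (ℤ.neg-distribʳ-* (+ m) (+ suc n)) ⟨
    ⟦ ℤ.- ((+ m) ℤ.* (+ suc n)) ⟧ᶻ   ≈⟨ neg-homo ((+ m) ℤ.* (+ suc n)) ⟩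
    - ⟦ (+ m) ℤ.* (+ suc n) ⟧ᶻ       ≈⟨ -‿cong (pos-*-homo m (suc n)) ⟩
    - (⟦ m ⟧ⁿ * ⟦ suc n ⟧ⁿ)          ≈⟨ -‿distribʳ-* _ _ ⟩
    ⟦ m ⟧ⁿ * - ⟦ suc n ⟧ⁿ            ∎

  *-homo : ∀ i j → ⟦ i ℤ.* j ⟧ᶻ ≈ ⟦ i ⟧ᶻ * ⟦ j ⟧ᶻ
  *-homo (+ m)    j = posˡ-*-homo m j
  *-homo -[1+ m ] j = begin
    ⟦ -[1+ m ] ℤ.* j ⟧ᶻ              ≡⟨ ≡.cong ⟦_⟧ᶻ (ℤ.neg-distribˡ-* (+ suc m) j) ⟨
    ⟦ ℤ.- ((+ suc m) ℤ.* j) ⟧ᶻ       ≈⟨ neg-homo ((+ suc m) ℤ.* j) ⟩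
    - ⟦ (+ suc m) ℤ.* j ⟧ᶻ           ≈⟨ -‿cong (posˡ-*-homo (suc m) j) ⟩
    - (⟦ suc m ⟧ⁿ * ⟦ j ⟧ᶻ)          ≈⟨ -‿distribˡ-* _ _ ⟩
    - ⟦ suc m ⟧ⁿ * ⟦ j ⟧ᶻ            ∎

  morphism : ℤ.+-*-rawRing -Raw-AlmostCommutative⟶ fromCommutativeRing R
  morphism = record
    { ⟦_⟧    = ⟦_⟧ᶻ
    ; +-homo = +-homo
    ; *-homo = *-homo
    ; -‿homo = neg-homo
    ; 0-homo = refl
    ; 1-homo = +-identityʳ 1#
    }

  -- Only a positive answer carries a proof: distinct integers may have equal images in a ring of
  -- positive characteristic.
  coefficient≟ : WeaklyDecidable (Induced-equivalence morphism)
  coefficient≟ i j = Maybe.map (reflexive ∘ ≡.cong ⟦_⟧ᶻ) (dec⇒maybe (i ℤ.≟ j))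

  open Algebra.Solver.Ring ℤ.+-*-rawRing (fromCommutativeRing R) morphism coefficient≟ public
    using (solve; con; _:+_; _:*_; _:-_; :-_; _:=_)

-- Arithmetic and finite sums in an ordered field.

module OrderedFieldProperties {c ℓ₁ ℓ₂} (F : OrderedField c ℓ₁ ℓ₂) where
  open OrderedField F public
  open CommutativeRing commutativeRing public
    using ( refl; sym; trans; reflexive; ring
          ; +-cong; +-congˡ; +-congʳ; +-identityˡ; +-identityʳ; +-comm
          ; *-congˡ; *-congʳ; *-identityˡ; *-identityʳ; *-comm; *-assoc
          ; distribʳ; zeroˡ; zeroʳ; -‿cong; -‿inverseʳ )
  open Algebra.Properties.Ring ring public using (-0#≈0#; x∙y⁻¹≈ε⇒x≈y; x≈y⇒x∙y⁻¹≈ε)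
  open Algebra.Properties.Semiring.Mult semiring public using (×-homo-+; ×1-homo-*)
  open Algebra.Properties.Semiring.Sum semiring public
    using ( sum-cong-≋; sum-replicate-zero; sum-init-last; ∑-distrib-+; ∑-comm
          ; *-distribˡ-sum; *-distribʳ-sum )
  open IntegerCoefficientSolver commutativeRing public
    using (solve; con; _:+_; _:*_; _:-_; :-_; _:=_)
  open IsDecTotalOrder isDecTotalOrder public using (antisym; total)
    renaming (refl to ≤-refl; trans to ≤-trans; reflexive to ≤-reflexive)

  poset : Poset c ℓ₁ ℓ₂
  poset = record { isPartialOrder = IsDecTotalOrder.isPartialOrder isDecTotalOrder }

  module ≈-Reasoning = Relation.Binary.Reasoning.Setoid setoid
  module ≤-Reasoning = Relation.Binary.Reasoning.PartialOrder poset

  ≤-resp-≈ : ∀ {x x′ y y′} → x ≈ x′ → y ≈ y′ → x ≤ y → x′ ≤ y′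
  ≤-resp-≈ x≈x′ y≈y′ x≤y = ≤-trans (≤-reflexive (sym x≈x′)) (≤-trans x≤y (≤-reflexive y≈y′))

  +-mono-≤ : ∀ {x y u v} → x ≤ y → u ≤ v → x + u ≤ y + v
  +-mono-≤ {y = y} {u} x≤y u≤v =
    ≤-trans (+-monoˡ-≤ u x≤y) (≤-resp-≈ (+-comm _ y) (+-comm _ y) (+-monoˡ-≤ y u≤v))

  x≤y⇒0≤y-x : ∀ {x y} → x ≤ y → 0# ≤ y - x
  x≤y⇒0≤y-x {x} x≤y = ≤-resp-≈ (-‿inverseʳ x) refl (+-monoˡ-≤ (- x) x≤y)

  0≤y-x⇒x≤y : ∀ {x y} → 0# ≤ y - x → x ≤ y
  0≤y-x⇒x≤y {x} {y} 0≤y-x = ≤-resp-≈ (+-identityˡ x)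
    (solve 2 (λ x y → (y :- x) :+ x := y) refl x y) (+-monoˡ-≤ x 0≤y-x)

  neg-mono-≤ : ∀ {x y} → x ≤ y → - y ≤ - x
  neg-mono-≤ {x} {y} x≤y = 0≤y-x⇒x≤y (≤-resp-≈ refl
    (solve 2 (λ x y → y :- x := (:- x) :- (:- y)) refl x y) (x≤y⇒0≤y-x x≤y))

  *-monoˡ-≤ : ∀ {x y z} → 0# ≤ z → x ≤ y → z * x ≤ z * y
  *-monoˡ-≤ {x} {y} {z} 0≤z x≤y = 0≤y-x⇒x≤y (≤-resp-≈ refl
    (solve 3 (λ x y z → z :* (y :- x) := z :* y :- z :* x) refl x y z)
    (*-nonNeg 0≤z (x≤y⇒0≤y-x x≤y)))

  +-nonNeg : ∀ {x y} → 0# ≤ x → 0# ≤ y → 0# ≤ x + y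
  +-nonNeg 0≤x 0≤y = ≤-resp-≈ (+-identityˡ 0#) refl (+-mono-≤ 0≤x 0≤y)

  square-nonNeg : ∀ x → 0# ≤ x * x
  square-nonNeg x with total 0# x
  ... | inj₁ 0≤x = *-nonNeg 0≤x 0≤x
  ... | inj₂ x≤0 = ≤-resp-≈ refl
    (solve 1 (λ x → (con (+ 0) :- x) :* (con (+ 0) :- x) := x :* x) refl x)
    (*-nonNeg (x≤y⇒0≤y-x x≤0) (x≤y⇒0≤y-x x≤0))

  0≤1 : 0# ≤ 1#
  0≤1 = ≤-resp-≈ refl (*-identityˡ 1#) (square-nonNeg 1#)

  ⟦⟧-nonNeg : ∀ n → 0# ≤ ⟦ n ⟧
  ⟦⟧-nonNeg zero    = ≤-refl
  ⟦⟧-nonNeg (suc n) = +-nonNeg 0≤1 (⟦⟧-nonNeg n)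

  ⟦⟧-mono : ∀ {m n} → m Nat.≤ n → ⟦ m ⟧ ≤ ⟦ n ⟧
  ⟦⟧-mono {n = n} Nat.z≤n = ⟦⟧-nonNeg n
  ⟦⟧-mono (Nat.s≤s m≤n)   = +-mono-≤ ≤-refl (⟦⟧-mono m≤n)

  ⟦⟧-homo-+ : ∀ m n → ⟦ m Nat.+ n ⟧ ≈ ⟦ m ⟧ + ⟦ n ⟧
  ⟦⟧-homo-+ = ×-homo-+ 1#

  -- Otherwise `1# ≤ 1# + ⟦ n ⟧ ≈ 0#`, and with `0≤1` antisymmetry identifies `0#` and `1#`.
  ⟦suc⟧≉0 : ∀ n → ¬ ⟦ suc n ⟧ ≈ 0#
  ⟦suc⟧≉0 n 1+n≈0 = 0≉1 (antisym 0≤1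
    (≤-resp-≈ (+-identityʳ 1#) 1+n≈0 (+-mono-≤ ≤-refl (⟦⟧-nonNeg n))))

  x≉0∧x*y≈0⇒y≈0 : ∀ {x y} → ¬ x ≈ 0# → x * y ≈ 0# → y ≈ 0#
  x≉0∧x*y≈0⇒y≈0 {x} {y} x≉0 xy≈0 = begin
    y                ≈⟨ *-identityˡ y ⟨
    1# * y           ≈⟨ *-congʳ (⁻¹-inverseʳ x x≉0) ⟨
    (x * x ⁻¹) * y   ≈⟨ solve 3 (λ x x⁻¹ y → x :* x⁻¹ :* y := x⁻¹ :* (x :* y)) refl x (x ⁻¹) y ⟩
    x ⁻¹ * (x * y)   ≈⟨ *-congˡ xy≈0 ⟩
    x ⁻¹ * 0#        ≈⟨ zeroʳ _ ⟩
    0#               ∎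
    where open ≈-Reasoning

  x*[y/x]≈y : ∀ {x y} → ¬ x ≈ 0# → x * (y / x) ≈ y
  x*[y/x]≈y {x} {y} x≉0 = begin
    x * (y * x ⁻¹)   ≈⟨ solve 3 (λ x y z → x :* (y :* z) := y :* (x :* z)) refl x y (x ⁻¹) ⟩
    y * (x * x ⁻¹)   ≈⟨ *-congˡ (⁻¹-inverseʳ x x≉0) ⟩
    y * 1#           ≈⟨ *-identityʳ y ⟩
    y                ∎
    where open ≈-Reasoning

  x*x≈0⇒x≈0 : ∀ {x} → x * x ≈ 0# → x ≈ 0#
  x*x≈0⇒x≈0 {x} x²≈0 with x ≟ 0#
  ... | yes x≈0 = x≈0
  ... | no  x≉0 = x≉0∧x*y≈0⇒y≈0 x≉0 x²≈0

  -- x⁻¹ = x · (x⁻¹)²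
  ⁻¹-nonNeg : ∀ {x} → ¬ x ≈ 0# → 0# ≤ x → 0# ≤ x ⁻¹
  ⁻¹-nonNeg {x} x≉0 0≤x = ≤-resp-≈ refl
    (begin
      x * (x ⁻¹ * x ⁻¹)  ≈⟨ *-assoc _ _ _ ⟨
      (x * x ⁻¹) * x ⁻¹  ≈⟨ *-congʳ (⁻¹-inverseʳ x x≉0) ⟩
      1# * x ⁻¹          ≈⟨ *-identityˡ _ ⟩
      x ⁻¹               ∎)
    (*-nonNeg 0≤x (square-nonNeg (x ⁻¹)))
    where open ≈-Reasoning

  *-cancelˡ-nonNeg : ∀ {x y} → ¬ x ≈ 0# → 0# ≤ x → 0# ≤ x * y → 0# ≤ y
  *-cancelˡ-nonNeg {x} {y} x≉0 0≤x 0≤xy = ≤-resp-≈ refl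
    (begin
      x ⁻¹ * (x * y)   ≈⟨ solve 3 (λ x x⁻¹ y → x⁻¹ :* (x :* y) := x :* x⁻¹ :* y) refl x (x ⁻¹) y ⟩
      (x * x ⁻¹) * y   ≈⟨ *-congʳ (⁻¹-inverseʳ x x≉0) ⟩
      1# * y           ≈⟨ *-identityˡ y ⟩
      y                ∎)
    (*-nonNeg (⁻¹-nonNeg x≉0 0≤x) 0≤xy)
    where open ≈-Reasoning

  *-cancelˡ-≤ : ∀ {x y z} → ¬ x ≈ 0# → 0# ≤ x → x * y ≤ x * z → y ≤ z
  *-cancelˡ-≤ {x} {y} {z} x≉0 0≤x xy≤xz = 0≤y-x⇒x≤y (*-cancelˡ-nonNeg x≉0 0≤x
    (≤-resp-≈ refl (solve 3 (λ x y z → x :* z :- x :* y := x :* (z :- y)) refl x y z)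
      (x≤y⇒0≤y-x xy≤xz)))

  x≤z*y⇒x/z≤y : ∀ {x y z} → ¬ z ≈ 0# → 0# ≤ z → x ≤ z * y → x / z ≤ y
  x≤z*y⇒x/z≤y z≉0 0≤z x≤zy =
    *-cancelˡ-≤ z≉0 0≤z (≤-resp-≈ (sym (x*[y/x]≈y z≉0)) refl x≤zy)

  z*y≤x⇒y≤x/z : ∀ {x y z} → ¬ z ≈ 0# → 0# ≤ z → z * y ≤ x → y ≤ x / z
  z*y≤x⇒y≤x/z z≉0 0≤z zy≤x =
    *-cancelˡ-≤ z≉0 0≤z (≤-resp-≈ refl (sym (x*[y/x]≈y z≉0)) zy≤x)

  sum-≈0 : ∀ {n} {f : Vector Carrier n} → (∀ i → f i ≈ 0#) → sum f ≈ 0#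
  sum-≈0 {n} f≈0 = trans (sum-cong-≋ f≈0) (sum-replicate-zero n)

  sum-sub : ∀ {n} (f g : Vector Carrier n) → sum (λ i → f i - g i) ≈ sum f - sum g
  sum-sub {zero}  f g = sym (-‿inverseʳ 0#)
  sum-sub {suc n} f g = trans (+-congˡ (sum-sub (f ∘ suc) (g ∘ suc)))
    (solve 4 (λ a b c d → (a :- b) :+ (c :- d) := (a :+ c) :- (b :+ d)) refl
      (f zero) (g zero) (sum (f ∘ suc)) (sum (g ∘ suc)))

  sum-const : ∀ n x → sum {n} (λ _ → x) ≈ ⟦ n ⟧ * x
  sum-const zero    x = sym (zeroˡ x)
  sum-const (suc n) x = trans (+-cong (sym (*-identityˡ x)) (sum-const n x)) (sym (distribʳ x 1# ⟦ n ⟧))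

  sum-mono : ∀ {n} {f g : Vector Carrier n} → (∀ i → f i ≤ g i) → sum f ≤ sum g
  sum-mono {zero}  f≤g = ≤-refl
  sum-mono {suc n} f≤g = +-mono-≤ (f≤g zero) (sum-mono (f≤g ∘ suc))

  sum-nonNeg : ∀ {n} {f : Vector Carrier n} → (∀ i → 0# ≤ f i) → 0# ≤ sum f
  sum-nonNeg {n} 0≤f = ≤-resp-≈ (sum-replicate-zero n) refl (sum-mono 0≤f)

  +-nonNeg-≈0 : ∀ {x y} → 0# ≤ x → 0# ≤ y → x + y ≈ 0# → x ≈ 0#
  +-nonNeg-≈0 0≤x 0≤y x+y≈0 =
    antisym (≤-resp-≈ (+-identityʳ _) x+y≈0 (+-mono-≤ ≤-refl 0≤y)) 0≤x

  sum-nonNeg-≈0 : ∀ {n} {f : Vector Carrier n} →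
                  (∀ i → 0# ≤ f i) → sum f ≈ 0# → ∀ i → f i ≈ 0#
  sum-nonNeg-≈0 0≤f ∑f≈0 zero    = +-nonNeg-≈0 (0≤f zero) (sum-nonNeg (0≤f ∘ suc)) ∑f≈0
  sum-nonNeg-≈0 0≤f ∑f≈0 (suc i) = sum-nonNeg-≈0 (0≤f ∘ suc)
    (+-nonNeg-≈0 (sum-nonNeg (0≤f ∘ suc)) (0≤f zero) (trans (+-comm _ _) ∑f≈0)) i

  ⟦⟧-homo-sum : ∀ {n} (f : Vector ℕ n) → ⟦ foldr Nat._+_ 0 f ⟧ ≈ sum (λ i → ⟦ f i ⟧)
  ⟦⟧-homo-sum {zero}  f = refl
  ⟦⟧-homo-sum {suc n} f = trans (⟦⟧-homo-+ (f zero) _) (+-congˡ (⟦⟧-homo-sum (f ∘ suc)))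

  -- The last entry is split off and bounded below by `0#`; each of the remaining `suc m` entries is
  -- at least the last among them, the one at `inject₁ (fromℕ m)`.
  penultimate-≤ : {θ : Vector Carrier (suc (suc m))} →
                  (∀ i j → i Fin.≤ j → θ j ≤ θ i) → (∀ i → 0# ≤ θ i) →
                  ⟦ suc m ⟧ * θ (inject₁ (fromℕ m)) ≤ sum θ
  penultimate-≤ {m} {θ} decreasing 0≤θ = begin
    ⟦ suc m ⟧ * θₘ
      ≈⟨ sum-const (suc m) θₘ ⟨
    sum {suc m} (λ _ → θₘ)
      ≈⟨ +-identityʳ _ ⟨
    sum {suc m} (λ _ → θₘ) + 0#
      ≤⟨ +-mono-≤ (sum-mono λ i → decreasing (inject₁ i) (inject₁ (fromℕ m)) (inject₁-≤ i)) (0≤θ _) ⟩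
    sum (λ i → θ (inject₁ i)) + θ (fromℕ (suc m))
      ≈⟨ sum-init-last θ ⟨
    sum θ ∎
    where
    open ≤-Reasoning
    θₘ = θ (inject₁ (fromℕ m))
    inject₁-≤ : ∀ i → inject₁ i Fin.≤ inject₁ (fromℕ m)
    inject₁-≤ i = ≡.subst₂ Nat._≤_
      (≡.sym (Fin.toℕ-inject₁ i)) (≡.sym (Fin.toℕ-inject₁ (fromℕ m))) (Fin.≤fromℕ i)

-- Dot products and orthogonal eigenvectors.

module SpectralTheory {c ℓ₁ ℓ₂} (F : OrderedField c ℓ₁ ℓ₂) where
  open OrderedFieldProperties F
  open LinearAlgebra F
  open ≈-Reasoning

  open import Data.Vec.Functional using ([]; _∷_)

  infixl 7 _·_
  _·_ : Vector Carrier n → Vector Carrier n → Carrier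
  x · y = sum λ i → x i * y i

  ·-comm : (x y : Vector Carrier n) → x · y ≈ y · x
  ·-comm x y = sum-cong-≋ λ i → *-comm (x i) (y i)

  ·-congˡ : (x : Vector Carrier n) {y z : Vector Carrier n} → (∀ i → y i ≈ z i) → x · y ≈ x · z
  ·-congˡ x y≈z = sum-cong-≋ λ i → *-congˡ (y≈z i)

  ·-scaleʳ : (x y : Vector Carrier n) (t : Carrier) → x · (λ i → t * y i) ≈ t * (x · y)
  ·-scaleʳ x y t = begin
    (sum λ i → x i * (t * y i))
      ≈⟨ (sum-cong-≋ λ i → solve 3 (λ x y t → x :* (t :* y) := t :* (x :* y))
           refl (x i) (y i) t) ⟩
    (sum λ i → t * (x i * y i))  ≈⟨ *-distribˡ-sum t (λ i → x i * y i) ⟨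
    t * (x · y)                  ∎

  ·-sub-scaleʳ : (x y z : Vector Carrier n) (t : Carrier) →
                 x · (λ i → y i - t * z i) ≈ x · y - t * (x · z)
  ·-sub-scaleʳ x y z t = begin
    (sum λ i → x i * (y i - t * z i))
      ≈⟨ (sum-cong-≋ λ i → solve 4 (λ x y z t → x :* (y :- t :* z) := x :* y :+ (:- t) :* (x :* z))
           refl (x i) (y i) (z i) t) ⟩
    (sum λ i → x i * y i + (- t) * (x i * z i))
      ≈⟨ ∑-distrib-+ (λ i → x i * y i) (λ i → (- t) * (x i * z i)) ⟩
    x · y + (sum λ i → (- t) * (x i * z i))
      ≈⟨ +-congˡ (*-distribˡ-sum (- t) (λ i → x i * z i)) ⟨
    x · y + (- t) * (x · z)
      ≈⟨ solve 3 (λ p t q → p :+ (:- t) :* q := p :- t :* q) refl (x · y) t (x · z) ⟩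
    x · y - t * (x · z) ∎

  ·-combination : (y : Vector Carrier n) (a : Vector Carrier k) (b : Vector (Vector Carrier n) k) →
                  y · combination a b ≈ sum λ j → a j * (y · b j)
  ·-combination y a b = begin
    (sum λ i → y i * sum λ j → a j * b j i)
      ≈⟨ (sum-cong-≋ λ i → *-distribˡ-sum (y i) (λ j → a j * b j i)) ⟩
    (sum λ i → sum λ j → y i * (a j * b j i))  ≈⟨ ∑-comm (λ i j → y i * (a j * b j i)) ⟩
    (sum λ j → y · λ i → a j * b j i)          ≈⟨ (sum-cong-≋ λ j → ·-scaleʳ y (b j) (a j)) ⟩
    (sum λ j → a j * (y · b j))                ∎

  ·-definite : (x : Vector Carrier n) → x · x ≈ 0# → ∀ i → x i ≈ 0#
  ·-definite x x·x≈0 i = x*x≈0⇒x≈0 (sum-nonNeg-≈0 (square-nonNeg ∘ x) x·x≈0 i)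

  diag-· : (x y : Vector Carrier n) → ∀ i → diag x i · y ≈ x i * y i
  diag-· x y zero    = trans (+-congˡ (sum-≈0 λ i → zeroˡ (y (suc i)))) (+-identityʳ _)
  diag-· x y (suc i) = trans (+-cong (zeroˡ (y zero)) (diag-· (x ∘ suc) (y ∘ suc) i)) (+-identityˡ _)

  diag-≡ : (x : Vector Carrier n) → ∀ i → diag x i i ≡ x i
  diag-≡ x i rewrite dec-true (i Fin.≟ i) ≡.refl = ≡.refl

  diag-≢ : (x : Vector Carrier n) → ∀ {i j} → i ≢ j → diag x i j ≡ 0#
  diag-≢ x {i} {j} i≢j rewrite dec-false (i Fin.≟ j) i≢j = ≡.refl

  -- The identity matrix; its rows double as the standard basis vectors.
  δ : Matrix n
  δ = diag λ _ → 1#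

  δ-· : (x : Vector Carrier n) → ∀ i → δ i · x ≈ x i
  δ-· x i = trans (diag-· (λ _ → 1#) x i) (*-identityˡ (x i))

  δ-refl : (i : Fin n) → δ i i ≈ 1#
  δ-refl i = reflexive (diag-≡ (λ _ → 1#) i)

  -- A vector of norm zero vanishes, and then the coefficients 1, 0, ..., 0 would be a nontrivial
  -- relation.
  independent⇒head≉0 : {b : Vector (Vector Carrier n) (suc k)} → LinearlyIndependent b →
                       ¬ b zero · b zero ≈ 0#
  independent⇒head≉0 {k = k} {b} independent b₀·b₀≈0 = 0≉1 (sym (independent (1# ∷ λ _ → 0#)
    (λ i → trans
      (+-cong (trans (*-identityˡ _) (·-definite (b zero) b₀·b₀≈0 i))
              (sum-≈0 λ j → zeroˡ (b (suc j) i)))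
      (+-identityˡ 0#))
    zero))

  -- A relation `a` among the sheared vectors is a relation among the original ones in which the
  -- head has coefficient `- ∑ a j * t j`.
  independent-shear : {b : Vector (Vector Carrier n) (suc k)} (t : Vector Carrier k) →
                      LinearlyIndependent b →
                      LinearlyIndependent λ j i → b (suc j) i - t j * b zero i
  independent-shear {b = b} t independent a combination≈0 j =
    independent ((sum λ j → - (a j * t j)) ∷ a) (λ i → trans (rearrange i) (combination≈0 i)) (suc j)
    where
    rearrange : ∀ i → (sum λ j → - (a j * t j)) * b zero i + (sum λ j → a j * b (suc j) i) ≈
                      sum λ j → a j * (b (suc j) i - t j * b zero i)
    rearrange i = begin
      (sum λ j → - (a j * t j)) * b zero i + (sum λ j → a j * b (suc j) i)
        ≈⟨ +-congʳ (*-distribʳ-sum (b zero i) (λ j → - (a j * t j))) ⟩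
      (sum λ j → - (a j * t j) * b zero i) + (sum λ j → a j * b (suc j) i)
        ≈⟨ ∑-distrib-+ (λ j → - (a j * t j) * b zero i) (λ j → a j * b (suc j) i) ⟨
      (sum λ j → - (a j * t j) * b zero i + a j * b (suc j) i)
        ≈⟨ (sum-cong-≋ λ j → solve 4 (λ a t x y → :- (a :* t) :* x :+ a :* y := a :* (y :- t :* x))
              refl (a j) (t j) (b zero i) (b (suc j) i)) ⟩
      (sum λ j → a j * (b (suc j) i - t j * b zero i)) ∎

  module _ (M : Matrix n) where

    -- State of one eigenspace during orthogonalisation: `cs` are the eigenvectors already split
    -- off, for any eigenvalue, and `vectors` are those still available.
    record IndependentEigenvectors (μ : Carrier) (cs : Vector (Vector Carrier n) k) (m : ℕ) :
           Set (c ⊔ˡ ℓ₁) where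
      field
        vectors       : Vector (Vector Carrier n) m
        eigenvector   : ∀ i → Eigenspace M μ (vectors i)
        perpendicular : ∀ i l → cs l · vectors i ≈ 0#
        independent   : LinearlyIndependent vectors

    -- Result of the recursion: `perpendicular` is what allows a vector of `cs` to be put in front
    -- of the list.
    record OrthogonalEigenvectors (θ : Vector Carrier m) (cs : Vector (Vector Carrier n) k) :
           Set (c ⊔ˡ ℓ₁) where
      field
        vectors       : Vector (Vector Carrier n) m
        eigenvector   : ∀ i → Eigenspace M (θ i) (vectors i)
        perpendicular : ∀ i l → cs l · vectors i ≈ 0#
        nonzero       : ∀ i → ¬ vectors i · vectors i ≈ 0#
        orthogonal    : ∀ {i j} → i ≢ j → vectors i · vectors j ≈ 0#

  multiplicity-≈ : ∀ {μ} (θ : Vector Carrier (suc m)) → μ ≈ θ zero →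
                   multiplicity μ θ ≡ suc (multiplicity μ (θ ∘ suc))
  multiplicity-≈ {μ = μ} θ μ≈θ₀ rewrite dec-true (μ ≟ θ zero) μ≈θ₀ = ≡.refl

  multiplicity-≉ : ∀ {μ} (θ : Vector Carrier (suc m)) → ¬ μ ≈ θ zero →
                   multiplicity μ θ ≡ multiplicity μ (θ ∘ suc)
  multiplicity-≉ {μ = μ} θ μ≉θ₀ rewrite dec-false (μ ≟ θ zero) μ≉θ₀ = ≡.refl

  multiplicity-cong : ∀ {μ ν} (θ : Vector Carrier m) → μ ≈ ν → multiplicity μ θ ≡ multiplicity ν θ
  multiplicity-cong {zero}              θ μ≈ν = ≡.refl
  multiplicity-cong {suc m} {μ} {ν} θ μ≈ν with ν ≟ θ zero
  ... | yes ν≈θ₀ = ≡.trans (multiplicity-≈ θ (trans μ≈ν ν≈θ₀)) (≡.cong suc (multiplicity-cong (θ ∘ suc) μ≈ν))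
  ... | no  ν≉θ₀ = ≡.trans (multiplicity-≉ θ (ν≉θ₀ ∘ trans (sym μ≈ν))) (multiplicity-cong (θ ∘ suc) μ≈ν)

  module _ {M : Matrix n} (M-sym : ∀ i j → M i j ≈ M j i) where

    self-adjoint : (x y : Vector Carrier n) → (sum λ i → (M i · x) * y i) ≈ sum λ i → x i * (M i · y)
    self-adjoint x y = begin
      (sum λ i → (M i · x) * y i)
        ≈⟨ (sum-cong-≋ λ i → *-distribʳ-sum (y i) (λ j → M i j * x j)) ⟩
      (sum λ i → sum λ j → M i j * x j * y i)
        ≈⟨ ∑-comm (λ i j → M i j * x j * y i) ⟩
      (sum λ j → sum λ i → M i j * x j * y i)
        ≈⟨ (sum-cong-≋ λ j → sum-cong-≋ λ i → trans (*-congʳ (*-congʳ (M-sym i j)))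
             (solve 3 (λ p x y → p :* x :* y := x :* (p :* y)) refl (M j i) (x j) (y i))) ⟩
      (sum λ j → sum λ i → x j * (M j i * y i))
        ≈⟨ (sum-cong-≋ λ j → *-distribˡ-sum (x j) (λ i → M j i * y i)) ⟨
      (sum λ j → x j * (M j · y))                ∎

    -- Moving `M` across the product gives `μ * (x · y) ≈ ν * (x · y)`, and `μ - ν` is invertible.
    eigenspaces-perpendicular : ∀ {μ ν x y} → ¬ μ ≈ ν → Eigenspace M μ x → Eigenspace M ν y → x · y ≈ 0#
    eigenspaces-perpendicular {μ} {ν} {x} {y} μ≉ν Mx≈μx My≈νy =
      x≉0∧x*y≈0⇒y≈0 (μ≉ν ∘ x∙y⁻¹≈ε⇒x≈y μ ν) (begin
        (μ - ν) * (x · y)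
          ≈⟨ solve 3 (λ μ ν p → (μ :- ν) :* p := μ :* p :- ν :* p) refl μ ν (x · y) ⟩
        μ * (x · y) - ν * (x · y)
          ≈⟨ x≈y⇒x∙y⁻¹≈ε (begin
               μ * (x · y)                  ≈⟨ *-distribˡ-sum μ (λ i → x i * y i) ⟩
               (sum λ i → μ * (x i * y i))
                 ≈⟨ (sum-cong-≋ λ i → trans (sym (*-assoc _ _ _)) (*-congʳ (sym (Mx≈μx i)))) ⟩
               (sum λ i → (M i · x) * y i)  ≈⟨ self-adjoint x y ⟩
               x · (λ i → M i · y)          ≈⟨ ·-congˡ x My≈νy ⟩
               x · (λ i → ν * y i)          ≈⟨ ·-scaleʳ x y ν ⟩
               ν * (x · y)                  ∎) ⟩
        0# ∎)

    -- Subtracting multiples of the head stays within the eigenspace of `μ`, and the head is itself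
    -- perpendicular to `cs`, so only perpendicularity to the head has to be arranged.
    orthogonaliseTail : ∀ {μ} {cs : Vector (Vector Carrier n) k}
                        (B : IndependentEigenvectors M μ cs (suc m)) →
                        IndependentEigenvectors M μ (IndependentEigenvectors.vectors B zero ∷ cs) m
    orthogonaliseTail {m = m} {μ} {cs} B = record
      { vectors       = b′
      ; eigenvector   = λ j i → begin
          M i · b′ j                                ≈⟨ ·-sub-scaleʳ (M i) (b (suc j)) x (t j) ⟩
          M i · b (suc j) - t j * (M i · x)
            ≈⟨ +-cong (eigenvector (suc j) i) (-‿cong (*-congˡ (eigenvector zero i))) ⟩
          μ * b (suc j) i - t j * (μ * x i)
            ≈⟨ solve 4 (λ μ y t x → μ :* y :- t :* (μ :* x) := μ :* (y :- t :* x))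
                 refl μ (b (suc j) i) (t j) (x i) ⟩
          μ * b′ j i                                ∎
      ; perpendicular = perpendicular′
      ; independent   = independent-shear {b = b} t independent
      }
      where
      open IndependentEigenvectors B renaming (vectors to b)
      x = b zero
      t : Vector Carrier m
      t j = (x · b (suc j)) / (x · x)
      b′ : Vector (Vector Carrier n) m
      b′ j i = b (suc j) i - t j * x i
      perpendicular′ : ∀ j l → (x ∷ cs) l · b′ j ≈ 0#
      perpendicular′ j zero = begin
        x · b′ j                           ≈⟨ ·-sub-scaleʳ x (b (suc j)) x (t j) ⟩
        x · b (suc j) - t j * (x · x)
          ≈⟨ solve 3 (λ p q r → p :- p :* q :* r := p :* (con (+ 1) :- r :* q))
               refl (x · b (suc j)) ((x · x) ⁻¹) (x · x) ⟩
        -- `⟦ 1 ⟧` rather than `1#`, since `con (+ 1)` evaluates to `1# + 0#`.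
        (x · b (suc j)) * (⟦ 1 ⟧ - (x · x) * (x · x) ⁻¹)
          ≈⟨ *-congˡ (+-cong (+-identityʳ 1#) (-‿cong (⁻¹-inverseʳ _ (independent⇒head≉0 {b = b} independent)))) ⟩
        (x · b (suc j)) * (1# - 1#)
          ≈⟨ *-congˡ (-‿inverseʳ 1#) ⟩
        (x · b (suc j)) * 0#               ≈⟨ zeroʳ _ ⟩
        0#                                 ∎
      perpendicular′ j (suc l) = begin
        cs l · b′ j                              ≈⟨ ·-sub-scaleʳ (cs l) (b (suc j)) x (t j) ⟩
        cs l · b (suc j) - t j * (cs l · x)
          ≈⟨ +-cong (perpendicular (suc j) l) (-‿cong (trans (*-congˡ (perpendicular zero l)) (zeroʳ _))) ⟩
        0# - 0#                                  ≈⟨ -‿inverseʳ 0# ⟩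
        0#                                       ∎

    adjoinPerpendicular : ∀ {μ ν x} {cs : Vector (Vector Carrier n) k} →
                          ¬ μ ≈ ν → Eigenspace M ν x →
                          IndependentEigenvectors M μ cs m → IndependentEigenvectors M μ (x ∷ cs) m
    adjoinPerpendicular {x = x} {cs} μ≉ν Mx≈νx B = record
      { vectors       = vectors
      ; eigenvector   = eigenvector
      ; perpendicular = λ
          { i zero    → eigenspaces-perpendicular (μ≉ν ∘ sym) Mx≈νx (eigenvector i)
          ; i (suc l) → perpendicular i l
          }
      ; independent   = independent
      }
      where open IndependentEigenvectors B

    eigenvalue-resp-≈ : ∀ {μ ν} {cs : Vector (Vector Carrier n) k} → μ ≈ ν →
                        IndependentEigenvectors M μ cs m → IndependentEigenvectors M ν cs m
    eigenvalue-resp-≈ μ≈ν B = record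
      { vectors       = vectors
      ; eigenvector   = λ j i → trans (eigenvector j i) (*-congʳ μ≈ν)
      ; perpendicular = perpendicular
      ; independent   = independent
      }
      where open IndependentEigenvectors B

    -- One Gram–Schmidt step per entry of θ: the new eigenvector x is split off
    -- from the eigenspace of θ₀, the other eigenspaces being already
    -- perpendicular to x.
    orthogonalise : (θ : Vector Carrier m) (cs : Vector (Vector Carrier n) k) →
                    (∀ μ → IndependentEigenvectors M μ cs (multiplicity μ θ)) →
                    OrthogonalEigenvectors M θ cs
    orthogonalise {zero} θ cs B = record
      { vectors       = λ ()
      ; eigenvector   = λ ()
      ; perpendicular = λ ()
      ; nonzero       = λ ()
      ; orthogonal    = λ { {()} }
      }
    orthogonalise {suc m} θ cs B = record
      { vectors       = x ∷ vectors
      ; eigenvector   = λ { zero → B₀.eigenvector zero ; (suc i) → eigenvector i }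
      ; perpendicular = λ { zero → B₀.perpendicular zero ; (suc i) l → perpendicular i (suc l) }
      ; nonzero       = λ { zero → independent⇒head≉0 {b = B₀.vectors} B₀.independent ; (suc i) → nonzero i }
      ; orthogonal    = orthogonal′
      }
      where
      -- `θ zero` occurs in `θ`, so its multiplicity is a successor and there is a vector to split
      -- off.
      B₀ : IndependentEigenvectors M (θ zero) cs (suc (multiplicity (θ zero) (θ ∘ suc)))
      B₀ = ≡.subst (IndependentEigenvectors M (θ zero) cs) (multiplicity-≈ θ refl) (B (θ zero))
      module B₀ = IndependentEigenvectors B₀

      x = B₀.vectors zero

      B′ : ∀ μ → IndependentEigenvectors M μ (x ∷ cs) (multiplicity μ (θ ∘ suc))
      B′ μ with μ ≟ θ zero
      -- `μ` and `θ zero` agree only up to `≈`, so both the count and the eigenvalue are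
      -- transported.
      ... | yes μ≈θ₀ = ≡.subst (IndependentEigenvectors M μ (x ∷ cs))
        (≡.sym (multiplicity-cong (θ ∘ suc) μ≈θ₀)) (eigenvalue-resp-≈ (sym μ≈θ₀) (orthogonaliseTail B₀))
      ... | no  μ≉θ₀ = ≡.subst (IndependentEigenvectors M μ (x ∷ cs))
        (multiplicity-≉ θ μ≉θ₀) (adjoinPerpendicular μ≉θ₀ (B₀.eigenvector zero) (B μ))

      open OrthogonalEigenvectors (orthogonalise (θ ∘ suc) (x ∷ cs) B′)

      orthogonal′ : ∀ {i j} → i ≢ j → (x ∷ vectors) i · (x ∷ vectors) j ≈ 0#
      orthogonal′ {zero}  {zero}  i≢j = contradiction ≡.refl i≢j
      orthogonal′ {zero}  {suc j} i≢j = perpendicular j zero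
      orthogonal′ {suc i} {zero}  i≢j = trans (·-comm (vectors i) x) (perpendicular i zero)
      orthogonal′ {suc i} {suc j} i≢j = orthogonal (i≢j ∘ ≡.cong suc)

  -- Expansion in an orthogonal basis.

  module OrthogonalBasis (e : Vector (Vector Carrier n) n)
                         (nonzero : ∀ i → ¬ e i · e i ≈ 0#)
                         (orthogonal : ∀ {i j} → i ≢ j → e i · e j ≈ 0#) where

    weight : Vector Carrier n
    weight i = (e i · e i) ⁻¹

    weight-nonNeg : ∀ i → 0# ≤ weight i
    weight-nonNeg i = ⁻¹-nonNeg (nonzero i) (sum-nonNeg (square-nonNeg ∘ e i))

    -- The matrix ∑ eᵢ eᵢᵀ / |eᵢ|² of the orthogonal projection onto the span of the `e i`, each row
    -- written as a combination of the `e i`.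
    projection : Matrix n
    projection u = combination (λ i → weight i * e i u) e

    gram : ∀ i j → e i · e j ≈ diag (λ i → e i · e i) i j
    gram i j with i Fin.≟ j
    ... | yes ≡.refl = refl
    ... | no  i≢j    = orthogonal i≢j

    -- The projection fixes `e i`: the Gram matrix is diagonal, so a single term of the expansion
    -- survives.
    ·-projection : ∀ i u → e i · projection u ≈ e i u
    ·-projection i u = begin
      e i · projection u
        ≈⟨ ·-combination (e i) a e ⟩
      (sum λ j → a j * (e i · e j))
        ≈⟨ ·-congˡ a (gram i) ⟩
      a · diag (λ i → e i · e i) i
        ≈⟨ ·-comm a _ ⟩
      diag (λ i → e i · e i) i · a
        ≈⟨ diag-· (λ i → e i · e i) a i ⟩
      (e i · e i) * (weight i * e i u)
        ≈⟨ *-assoc _ _ _ ⟨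
      (e i · e i) * weight i * e i u
        ≈⟨ *-congʳ (⁻¹-inverseʳ _ (nonzero i)) ⟩
      1# * e i u
        ≈⟨ *-identityˡ _ ⟩
      e i u ∎
      where
      a : Vector Carrier n
      a j = weight j * e j u

    projection-idempotent : ∀ u → projection u · projection u ≈ projection u u
    projection-idempotent u = begin
      projection u · projection u
        ≈⟨ ·-combination (projection u) a e ⟩
      (sum λ i → a i * (projection u · e i))
        ≈⟨ ·-congˡ a (λ i → trans (·-comm (projection u) (e i)) (·-projection i u)) ⟩
      projection u u ∎
      where
      a : Vector Carrier n
      a i = weight i * e i u

    -- The left side is the trace of the rank-one projection onto `e i`.
    weighted-norm : ∀ i → (sum λ u → weight i * e i u * e i u) ≈ 1#
    weighted-norm i = begin
      (sum λ u → weight i * e i u * e i u)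
        ≈⟨ (sum-cong-≋ λ u → *-assoc (weight i) (e i u) (e i u)) ⟩
      (sum λ u → weight i * (e i u * e i u))  ≈⟨ *-distribˡ-sum (weight i) (λ u → e i u * e i u) ⟨
      weight i * (e i · e i)                  ≈⟨ *-comm _ _ ⟩
      (e i · e i) * weight i                  ≈⟨ ⁻¹-inverseʳ _ (nonzero i) ⟩
      1#                                      ∎

    -- The factor `1#` gives the rows the form expected by `·-sub-scaleʳ`.
    residual : Matrix n
    residual u v = δ u v - 1# * projection u v

    -- By idempotence a row of `residual` is perpendicular to the same row of `projection`, so its
    -- squared norm is its product with `δ u`, a diagonal entry.
    residual-norm : ∀ u → residual u · residual u ≈ 1# - projection u u
    residual-norm u = begin
      residual u · residual u
        ≈⟨ ·-sub-scaleʳ (residual u) (δ u) (projection u) 1# ⟩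
      residual u · δ u - 1# * (residual u · projection u)
        ≈⟨ +-cong
             (begin
               residual u · δ u            ≈⟨ ·-comm (residual u) (δ u) ⟩
               δ u · residual u            ≈⟨ δ-· (residual u) u ⟩
               δ u u - 1# * projection u u ≈⟨ +-cong (δ-refl u) (-‿cong (*-identityˡ _)) ⟩
               1# - projection u u         ∎)
             (-‿cong (trans (*-identityˡ _) (begin
               residual u · projection u
                 ≈⟨ ·-comm (residual u) (projection u) ⟩
               projection u · residual u
                 ≈⟨ ·-sub-scaleʳ (projection u) (δ u) (projection u) 1# ⟩
               projection u · δ u - 1# * (projection u · projection u)
                 ≈⟨ +-cong (trans (·-comm (projection u) (δ u)) (δ-· (projection u) u))
                           (-‿cong (trans (*-identityˡ _) (projection-idempotent u))) ⟩
               projection u u - projection u u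
                 ≈⟨ -‿inverseʳ _ ⟩
               0# ∎))) ⟩
      1# - projection u u - 0#
        ≈⟨ trans (+-congˡ -0#≈0#) (+-identityʳ _) ⟩
      1# - projection u u ∎

    residual-norm-sum : (sum λ u → residual u · residual u) ≈ 0#
    residual-norm-sum = begin
      (sum λ u → residual u · residual u)
        ≈⟨ sum-cong-≋ residual-norm ⟩
      (sum λ u → 1# - projection u u)
        ≈⟨ sum-sub (λ _ → 1#) (λ u → projection u u) ⟩
      sum {n} (λ _ → 1#) - (sum λ u → projection u u)
        ≈⟨ x≈y⇒x∙y⁻¹≈ε (sym (begin
             (sum λ u → sum λ i → weight i * e i u * e i u)
               ≈⟨ ∑-comm (λ u i → weight i * e i u * e i u) ⟩
             (sum λ i → sum λ u → weight i * e i u * e i u)  ≈⟨ sum-cong-≋ weighted-norm ⟩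
             sum {n} (λ _ → 1#)                              ∎)) ⟩
      0# ∎

    -- The residual of the projection onto the span of the e i has trace n - n,
    -- and its trace is the sum of its squared entries.
    resolution-of-identity : ∀ u v → δ u v ≈ sum λ i → weight i * e i u * e i v
    resolution-of-identity u v = trans
      (x∙y⁻¹≈ε⇒x≈y _ _ (·-definite (residual u)
        (sum-nonNeg-≈0 (λ u → sum-nonNeg (square-nonNeg ∘ residual u)) residual-norm-sum u) v))
      (*-identityˡ _)

  -- The quadratic form of `A` at the vector `δ u - δ v`, spelled out in entries so that it is
  -- visibly linear in `A`.
  difference : Matrix n → Fin n → Fin n → Carrier
  difference A u v = (A u u - A u v) - (A v u - A v v)

  difference-sum : ∀ (f : Vector Carrier k) (A : Vector (Matrix n) k) u v →
                   difference (λ u v → sum λ i → f i * A i u v) u v ≈ sum λ i → f i * difference (A i) u v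
  difference-sum f A u v = begin
    (s u u - s u v) - (s v u - s v v)
      ≈⟨ +-cong (sum-sub (t u u) (t u v)) (-‿cong (sum-sub (t v u) (t v v))) ⟨
    (sum λ i → t u u i - t u v i) - (sum λ i → t v u i - t v v i)
      ≈⟨ sum-sub (λ i → t u u i - t u v i) (λ i → t v u i - t v v i) ⟨
    (sum λ i → (t u u i - t u v i) - (t v u i - t v v i))
      ≈⟨ (sum-cong-≋ λ i → solve 5 (λ f a b c d →
            (f :* a :- f :* b) :- (f :* c :- f :* d) := f :* ((a :- b) :- (c :- d))) refl
            (f i) (A i u u) (A i u v) (A i v u) (A i v v)) ⟩
    (sum λ i → f i * difference (A i) u v) ∎
    where
    t : _ → _ → Vector Carrier _
    t u v i = f i * A i u v
    s : _ → _ → Carrier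
    s u v = sum (t u v)

  difference-cong : ∀ {A B : Matrix n} → (∀ u v → A u v ≈ B u v) → ∀ u v → difference A u v ≈ difference B u v
  difference-cong A≈B u v =
    +-cong (+-cong (A≈B u u) (-‿cong (A≈B u v))) (-‿cong (+-cong (A≈B v u) (-‿cong (A≈B v v))))

  -- Trace and eigenvalue bounds for a symmetric matrix.

  module EigenvalueBounds {M : Matrix n} (M-sym : ∀ i j → M i j ≈ M j i)
                          {θ : Vector Carrier n} (θ-eigenvalues : Eigenvalues M θ) where
    open Eigenvalues θ-eigenvalues

    orthogonalEigenvectors : OrthogonalEigenvectors M θ []
    orthogonalEigenvectors = orthogonalise M-sym θ [] λ μ → record
      { vectors       = Basis.vectors (dimension μ)
      ; eigenvector   = Basis.inSubspace (dimension μ)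
      ; perpendicular = λ _ ()
      ; independent   = Basis.independent (dimension μ)
      }

    open OrthogonalEigenvectors orthogonalEigenvectors renaming (vectors to e)
    open OrthogonalBasis e nonzero orthogonal

    -- The entry is `M v · δ u`; expanding `δ u` in the `e i` lets `M` act on each eigenvector as
    -- `θ i`.
    spectral-decomposition : ∀ u v → M u v ≈ sum λ i → θ i * (weight i * e i u * e i v)
    spectral-decomposition u v = begin
      M u v
        ≈⟨ M-sym u v ⟩
      M v u
        ≈⟨ δ-· (M v) u ⟨
      δ u · M v
        ≈⟨ ·-comm (δ u) (M v) ⟩
      M v · δ u
        ≈⟨ ·-congˡ (M v) (resolution-of-identity u) ⟩
      M v · projection u
        ≈⟨ ·-combination (M v) (λ i → weight i * e i u) e ⟩
      (sum λ i → weight i * e i u * (M v · e i))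
        ≈⟨ (sum-cong-≋ λ i → trans (*-congˡ (eigenvector i v))
              (solve 3 (λ a t x → a :* (t :* x) := t :* (a :* x))
                   refl (weight i * e i u) (θ i) (e i v))) ⟩
      (sum λ i → θ i * (weight i * e i u * e i v)) ∎

    trace≈sum : (sum λ u → M u u) ≈ sum θ
    trace≈sum = begin
      (sum λ u → M u u)
        ≈⟨ (sum-cong-≋ λ u → spectral-decomposition u u) ⟩
      (sum λ u → sum λ i → θ i * (weight i * e i u * e i u))
        ≈⟨ ∑-comm (λ u i → θ i * (weight i * e i u * e i u)) ⟩
      (sum λ i → sum λ u → θ i * (weight i * e i u * e i u))
        ≈⟨ (sum-cong-≋ λ i → *-distribˡ-sum (θ i) (λ u → weight i * e i u * e i u)) ⟨
      (sum λ i → θ i * sum λ u → weight i * e i u * e i u)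
        ≈⟨ (sum-cong-≋ λ i → trans (*-congˡ (weighted-norm i)) (*-identityʳ (θ i))) ⟩
      sum θ ∎

    -- The Rayleigh quotient of the vector δ u - δ v.
    difference-≤ : ∀ {τ} → (∀ i → θ i ≤ τ) → ∀ u v → difference M u v ≤ τ * difference δ u v
    difference-≤ {τ} θ≤τ u v = ≤-resp-≈
      (begin
        (sum λ i → θ i * difference (A i) u v)
          ≈⟨ difference-sum θ A u v ⟨
        difference (λ u v → sum λ i → θ i * A i u v) u v
          ≈⟨ difference-cong spectral-decomposition u v ⟨
        difference M u v ∎)
      (begin
        (sum λ i → τ * difference (A i) u v)
          ≈⟨ (sum-cong-≋ λ i → *-congˡ (*-identityˡ (difference (A i) u v))) ⟨
        -- The coefficients `1#` make the sum a case of `difference-sum`, whose matrix is `δ` by the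
        -- resolution of the identity.
        (sum λ i → τ * (1# * difference (A i) u v))
          ≈⟨ *-distribˡ-sum τ (λ i → 1# * difference (A i) u v) ⟨
        (τ * sum λ i → 1# * difference (A i) u v)
          ≈⟨ *-congˡ (difference-sum (λ _ → 1#) A u v) ⟨
        τ * difference (λ u v → sum λ i → 1# * A i u v) u v
          ≈⟨ *-congˡ (difference-cong (λ u v →
               trans (sum-cong-≋ λ i → *-identityˡ (A i u v)) (sym (resolution-of-identity u v))) u v) ⟩
        τ * difference δ u v ∎)
      -- Termwise comparison is possible because the form of each rank-one matrix is `weight i`
      -- times the square of `e i u - e i v`, hence nonnegative.
      (sum-mono λ i → ≤-resp-≈ (*-comm _ _) (*-comm _ _) (*-monoˡ-≤
        (≤-resp-≈ refl (solve 3 (λ w x y →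
            w :* ((x :- y) :* (x :- y)) := (w :* x :* x :- w :* x :* y) :- (w :* y :* x :- w :* y :* y)) refl
            (weight i) (e i u) (e i v))
          (*-nonNeg (weight-nonNeg i) (square-nonNeg (e i u - e i v))))
        (θ≤τ i)))
      where
      A : Vector (Matrix n) n
      A i u v = weight i * e i u * e i v

    -- At `e i` the form takes the value `θ i` times the positive number `e i · e i`.
    eigenvalue-nonNeg : (∀ x → 0# ≤ x · λ i → M i · x) → ∀ i → 0# ≤ θ i
    eigenvalue-nonNeg 0≤M i = *-cancelˡ-nonNeg (nonzero i) (sum-nonNeg (square-nonNeg ∘ e i))
      (≤-resp-≈ refl
        (begin
          (e i · λ j → M j · e i)    ≈⟨ ·-congˡ (e i) (eigenvector i) ⟩
          (e i · λ j → θ i * e i j)  ≈⟨ ·-scaleʳ (e i) (e i) (θ i) ⟩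
          θ i * (e i · e i)          ≈⟨ *-comm _ _ ⟩
          (e i · e i) * θ i          ∎)
        (0≤M (e i)))

-- Maxima and sums of natural numbers.

module NaturalVectors where
  open import Data.Nat.Base using (_⊔_; _≤_; _+_; _*_; z≤n)
  open Algebra.Properties.CommutativeMonoid.Sum Nat.+-0-commutativeMonoid using (sum; ∑-distrib-+)

  ≤-maximum : (f : Vector ℕ n) → ∀ i → f i ≤ foldr _⊔_ 0 f
  ≤-maximum f zero    = Nat.m≤m⊔n (f zero) _
  ≤-maximum f (suc i) = Nat.≤-trans (≤-maximum (f ∘ suc) i) (Nat.m≤n⊔m (f zero) _)

  maximum-attained : (f : Vector ℕ (suc n)) → ∃ λ i → f i ≡ foldr _⊔_ 0 f
  maximum-attained {zero}  f = zero , ≡.sym (Nat.⊔-identityʳ (f zero))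
  maximum-attained {suc n} f with Nat.⊔-sel (f zero) (foldr _⊔_ 0 (f ∘ suc)) | maximum-attained (f ∘ suc)
  ... | inj₁ max≡head | _             = zero , ≡.sym max≡head
  ... | inj₂ max≡tail | i , fᵢ≡tail = suc i , ≡.trans fᵢ≡tail (≡.sym max≡tail)

  sum-≥ : (f : Vector ℕ n) → (∀ i → k ≤ f i) → n * k ≤ sum f
  sum-≥ {zero}  f k≤f = z≤n
  sum-≥ {suc n} f k≤f = Nat.+-mono-≤ (k≤f zero) (sum-≥ (f ∘ suc) (k≤f ∘ suc))

  -- The `k` added on the right stands in for the exceptional term, which avoids truncated
  -- subtraction.
  sum-≥-except : (f : Vector ℕ n) → ∀ i → (∀ j → j ≢ i → k ≤ f j) → n * k ≤ k + sum f
  sum-≥-except {k = k} f zero    k≤f = Nat.+-monoʳ-≤ k (Nat.≤-trans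
    (sum-≥ (f ∘ suc) λ j → k≤f (suc j) λ ()) (Nat.m≤n+m _ (f zero)))
  sum-≥-except {suc n} {k} f (suc i) k≤f = Nat.+-monoʳ-≤ k (Nat.≤-trans
    (sum-≥-except (f ∘ suc) i λ j j≢i → k≤f (suc j) (j≢i ∘ Fin.suc-injective))
    (Nat.+-monoˡ-≤ _ (k≤f zero λ ())))

  sum-+-≥ : (f g : Vector ℕ n) → (∀ i → k ≤ f i + g i) → n * k ≤ sum f + sum g
  sum-+-≥ f g k≤f+g = ≡.subst (_ ≤_) (∑-distrib-+ f g) (sum-≥ _ k≤f+g)

open NaturalVectors

-- Shortest walks and transmissions.

module Distance {n} (G : ConnectedGraph n) where
  open ConnectedGraph G
  open import Data.Nat.Base using (_≤_; _<_; _+_; _*_; _∸_)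
  open Nat.≤-Reasoning

  shortestWalk : ∀ u v → Walk u v (dist u v)
  shortestWalk u v = proj₁ (proj₂ (least (walk? u v) (proj₁ (connected u v)) (proj₂ (connected u v))))

  dist-≤ : ∀ {u v k} → Walk u v k → dist u v ≤ k
  dist-≤ {u} {v} = proj₂ (proj₂ (least (walk? u v) (proj₁ (connected u v)) (proj₂ (connected u v)))) _

  append : ∀ {u w v j k} → Walk u w j → Walk w v k → Walk u v (j + k)
  append []      q = q
  append (e ∷ p) q = e ∷ append p q

  reverse : ∀ {u v k} → Walk u v k → Walk v u k
  reverse []      = []
  reverse (e ∷ p) = ≡.subst (Walk _ _) (Nat.+-comm _ 1) (append (reverse p) (~-sym e ∷ []))

  split : ∀ {u v} j {k} → Walk u v (j + k) → ∃ λ w → Walk u w j × Walk w v k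
  split zero    p       = _ , [] , p
  split (suc j) (e ∷ p) with split j p
  ... | w , q , r = w , e ∷ q , r

  dist-sym : ∀ u v → dist u v ≡ dist v u
  dist-sym u v = Nat.≤-antisym (dist-≤ (reverse (shortestWalk v u))) (dist-≤ (reverse (shortestWalk u v)))

  dist-refl : ∀ u → dist u u ≡ 0
  dist-refl u = Nat.n≤0⇒n≡0 (dist-≤ [])

  dist-triangle : ∀ u w v → dist u v ≤ dist u w + dist w v
  dist-triangle u w v = dist-≤ (append (shortestWalk u w) (shortestWalk w v))

  dist-positive : ∀ {u v} → u ≢ v → 1 ≤ dist u v
  dist-positive {u} {v} u≢v with dist u v | shortestWalk u v
  ... | zero  | [] = contradiction ≡.refl u≢v
  ... | suc _ | _  = Nat.s≤s Nat.z≤n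

  -- Cut a shortest walk after `j` steps: if the cut vertex were closer to `u` than `j`, the
  -- triangle inequality would make `v` closer than `dist u v`.
  vertexAtDistance : ∀ u v j → j ≤ dist u v → ∃ λ w → dist u w ≡ j
  vertexAtDistance u v j j≤d
    with split j {dist u v ∸ j} (≡.subst (Walk u v) (≡.sym (Nat.m+[n∸m]≡n j≤d)) (shortestWalk u v))
  ... | w , p , q = w , Nat.≤-antisym (dist-≤ p) (Nat.+-cancelʳ-≤ (dist u v ∸ j) j (dist u w) (begin
    j + (dist u v ∸ j)         ≡⟨ Nat.m+[n∸m]≡n j≤d ⟩
    dist u v                   ≤⟨ dist-triangle u w v ⟩
    dist u w + dist w v        ≤⟨ Nat.+-monoʳ-≤ (dist u w) (dist-≤ q) ⟩
    dist u w + (dist u v ∸ j)  ∎))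

  -- Vertices at distances 0, ..., `dist u v` from `u` are pairwise distinct, which injects
  -- `Fin (suc (dist u v))` into the vertex set.
  dist-< : ∀ u v → dist u v < n
  dist-< u v = Fin.injective⇒≤ {f = proj₁ ∘ vertex} λ {i} {j} wᵢ≡wⱼ → Fin.toℕ-injective
    (≡.trans (≡.sym (proj₂ (vertex i))) (≡.trans (≡.cong (dist u) wᵢ≡wⱼ) (proj₂ (vertex j))))
    where
    vertex : (i : Fin (suc (dist u v))) → ∃ λ w → dist u w ≡ toℕ i
    vertex i = vertexAtDistance u v (toℕ i) (Nat.s≤s⁻¹ (Fin.toℕ<n i))

  dist-≤-diameter : ∀ u v → dist u v ≤ diameter
  dist-≤-diameter u v = Nat.≤-trans (≤-maximum (dist u) v) (≤-maximum (λ u → foldr Nat._⊔_ 0 (dist u)) u)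

  transmission-≥ : ∀ v → n * 1 ≤ 1 + transmission v
  transmission-≥ v = sum-≥-except (λ u → dist u v) v λ _ → dist-positive

  -- The triangle inequality through `w`, summed over all n vertices `w`.
  transmission-+-≥ : ∀ u v → n * dist u v ≤ transmission u + transmission v
  transmission-+-≥ u v = sum-+-≥ (λ w → dist w u) (λ w → dist w v) λ w →
    ≡.subst (λ d → dist u v ≤ d + dist w v) (dist-sym u w) (dist-triangle u w v)

  -- For distance 1 the triangle inequality is too weak.
  transmission-bound : ∀ {u v} → u ≢ v →
    2 * n + dist u v * dist u v + 1 ≤ transmission u + transmission v + 4 * dist u v
  transmission-bound {u} {v} u≢v
    with dist u v | dist-positive u≢v | Nat.<⇒≤ (dist-< u v) | transmission-+-≥ u v
  ... | 1 | _ | _ | _ = begin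
    2 * n + 1 * 1 + 1                                       ≡⟨ arithmetic n ⟩
    n * 1 + n * 1 + 2
      ≤⟨ Nat.+-monoˡ-≤ 2 (Nat.+-mono-≤ (transmission-≥ u) (transmission-≥ v)) ⟩
    (1 + transmission u) + (1 + transmission v) + 2
      ≡⟨ arithmetic′ (transmission u) (transmission v) ⟩
    transmission u + transmission v + 4 * 1                 ∎
    where
    arithmetic : ∀ n → 2 * n + 1 * 1 + 1 ≡ n * 1 + n * 1 + 2
    arithmetic = solve-∀
    arithmetic′ : ∀ s t → (1 + s) + (1 + t) + 2 ≡ s + t + 4 * 1
    arithmetic′ = solve-∀
  ... | suc (suc e) | _ | d≤n | nd≤Tr = begin
    2 * n + (2 + e) * (2 + e) + 1                           ≡⟨ arithmetic n e ⟩
    -- Here d = 2 + e: the part `n * e` of nd absorbs the square `e * e`, and 3 is to spare.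
    e * e + (2 * n + 4 * e + 5)
      ≤⟨ Nat.+-mono-≤ (Nat.*-monoˡ-≤ e (Nat.≤-trans (Nat.m≤n+m e 2) d≤n)) (Nat.m≤m+n _ 3) ⟩
    n * e + (2 * n + 4 * e + 5 + 3)                         ≡⟨ arithmetic′ n e ⟩
    n * (2 + e) + 4 * (2 + e)                               ≤⟨ Nat.+-monoˡ-≤ (4 * (2 + e)) nd≤Tr ⟩
    transmission u + transmission v + 4 * (2 + e)           ∎
    where
    arithmetic : ∀ n e → 2 * n + (2 + e) * (2 + e) + 1 ≡ e * e + (2 * n + 4 * e + 5)
    arithmetic = solve-∀
    arithmetic′ : ∀ n e → n * e + (2 * n + 4 * e + 5 + 3) ≡ n * (2 + e) + 4 * (2 + e)
    arithmetic′ = solve-∀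

-- Two distinct vertices exist, so the diameter is positive and cannot be attained at a pair of
-- equal vertices.
diametralPair : (G : ConnectedGraph (suc (suc m))) → let open ConnectedGraph G in
                ∃ λ u → ∃ λ v → u ≢ v × dist u v ≡ diameter
diametralPair G with maximum-attained (λ u → foldr Nat._⊔_ 0 (ConnectedGraph.dist G u))
... | u , maxᵤ≡d with maximum-attained (ConnectedGraph.dist G u)
...   | v , duv≡maxᵤ = u , v , u≢v , duv≡d
  where
  open ConnectedGraph G
  open Distance G
  duv≡d : dist u v ≡ diameter
  duv≡d = ≡.trans duv≡maxᵤ maxᵤ≡d
  u≢v : u ≢ v
  u≢v ≡.refl = contradiction
    (Nat.≤-trans (dist-positive {zero} {suc zero} λ ()) (dist-≤-diameter zero (suc zero)))
    (Nat.<⇒≱ (Nat.s≤s (Nat.≤-reflexive (≡.trans (≡.sym duv≡d) (dist-refl u)))))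

-- Entries, trace and positivity of the distance Laplacian.

module DistanceLaplacianProperties {c ℓ₁ ℓ₂} (F : OrderedField c ℓ₁ ℓ₂) where
  open OrderedFieldProperties F
  open DistanceLaplacian F
  open SpectralTheory F

  diag-sym : (x : Vector Carrier n) → ∀ i j → diag x i j ≈ diag x j i
  diag-sym x i j with i Fin.≟ j
  ... | yes ≡.refl = reflexive (≡.sym (diag-≡ x i))
  ... | no  i≢j    = reflexive (≡.sym (diag-≢ x (i≢j ∘ ≡.sym)))

  -- This is the squared length of `δ u - δ v`, the denominator of the Rayleigh quotient.
  difference-δ : ∀ {u v : Fin n} → u ≢ v → difference δ u v ≈ ⟦ 2 ⟧
  difference-δ {u = u} {v} u≢v = begin
    (δ u u - δ u v) - (δ v u - δ v v)
      ≈⟨ +-cong (+-cong (δ-refl u) (-‿cong (reflexive (diag-≢ _ u≢v))))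
                (-‿cong (+-cong (reflexive (diag-≢ _ (u≢v ∘ ≡.sym))) (-‿cong (δ-refl v)))) ⟩
    (1# - 0#) - (0# - 1#)
      ≈⟨ solve 2 (λ x z → (x :- z) :- (z :- x) := x :+ (x :+ (con (+ 0) :- z :- z))) refl 1# 0# ⟩
    1# + (1# + (0# - 0# - 0#))
      ≈⟨ +-congˡ (+-congˡ (trans (+-congʳ (-‿inverseʳ 0#)) (-‿inverseʳ 0#))) ⟩
    ⟦ 2 ⟧ ∎
    where open ≈-Reasoning

  -- 2 ∑ f u v = ∑ (f u v + f v u)
  double-sum-nonNeg : (f : Fin n → Fin n → Carrier) → (∀ u v → 0# ≤ f u v + f v u) →
                      0# ≤ sum λ u → sum (f u)
  double-sum-nonNeg f 0≤f+fᵀ with total 0# (sum λ u → sum (f u))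
  ... | inj₁ 0≤∑ = 0≤∑
  ... | inj₂ ∑≤0 = begin
    0#
      ≤⟨ sum-nonNeg (λ u → sum-nonNeg (0≤f+fᵀ u)) ⟩
    (sum λ u → sum λ v → f u v + f v u)
      ≈⟨ (sum-cong-≋ λ u → ∑-distrib-+ (f u) (λ v → f v u)) ⟩
    (sum λ u → sum (f u) + sum λ v → f v u)
      ≈⟨ ∑-distrib-+ (λ u → sum (f u)) (λ u → sum λ v → f v u) ⟩
    (sum λ u → sum (f u)) + (sum λ u → sum λ v → f v u)
      ≈⟨ +-congˡ (∑-comm (λ u v → f v u)) ⟩
    (sum λ u → sum (f u)) + (sum λ u → sum (f u))
      ≤⟨ +-mono-≤ ∑≤0 ≤-refl ⟩
    0# + (sum λ u → sum (f u))
      ≈⟨ +-identityˡ _ ⟩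
    (sum λ u → sum (f u)) ∎
    where open ≤-Reasoning

  -- The bound on naturals has `4 * d` on the right in place of a subtraction; `⟦ 2 ⟧ * ⟦ d ⟧` is
  -- subtracted only after passing to the field.
  cast-bound : ∀ n d t τ → 2 Nat.* n Nat.+ d Nat.* d Nat.+ 1 Nat.≤ t Nat.+ 4 Nat.* d →
               ⟦ t Nat.+ (d Nat.+ d) ⟧ ≤ τ →
               ⟦ 2 ⟧ * ⟦ n ⟧ + ⟦ d ⟧ * ⟦ d ⟧ - ⟦ 2 ⟧ * ⟦ d ⟧ + 1# ≤ τ
  cast-bound n d t τ bound ⟦t+2d⟧≤τ =
    ≤-trans (≤-resp-≈ shiftˡ shiftʳ (+-monoˡ-≤ (- (⟦ 2 ⟧ * ⟦ d ⟧)) (⟦⟧-mono bound))) ⟦t+2d⟧≤τ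
    where
    open ≈-Reasoning
    shiftˡ : ⟦ 2 Nat.* n Nat.+ d Nat.* d Nat.+ 1 ⟧ - ⟦ 2 ⟧ * ⟦ d ⟧ ≈
             ⟦ 2 ⟧ * ⟦ n ⟧ + ⟦ d ⟧ * ⟦ d ⟧ - ⟦ 2 ⟧ * ⟦ d ⟧ + 1#
    shiftˡ = begin
      ⟦ 2 Nat.* n Nat.+ d Nat.* d Nat.+ 1 ⟧ - ⟦ 2 ⟧ * ⟦ d ⟧
        ≈⟨ +-congʳ (trans (⟦⟧-homo-+ (2 Nat.* n Nat.+ d Nat.* d) 1)
             (+-cong (⟦⟧-homo-+ (2 Nat.* n) (d Nat.* d)) (+-identityʳ 1#))) ⟩
      ⟦ 2 Nat.* n ⟧ + ⟦ d Nat.* d ⟧ + 1# - ⟦ 2 ⟧ * ⟦ d ⟧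
        ≈⟨ +-congʳ (+-congʳ (+-cong (×1-homo-* 2 n) (×1-homo-* d d))) ⟩
      ⟦ 2 ⟧ * ⟦ n ⟧ + ⟦ d ⟧ * ⟦ d ⟧ + 1# - ⟦ 2 ⟧ * ⟦ d ⟧
        ≈⟨ solve 3 (λ p q o → p :+ o :- q := p :- q :+ o)
             refl (⟦ 2 ⟧ * ⟦ n ⟧ + ⟦ d ⟧ * ⟦ d ⟧) (⟦ 2 ⟧ * ⟦ d ⟧) 1# ⟩
      ⟦ 2 ⟧ * ⟦ n ⟧ + ⟦ d ⟧ * ⟦ d ⟧ - ⟦ 2 ⟧ * ⟦ d ⟧ + 1# ∎
    shiftʳ : ⟦ t Nat.+ 4 Nat.* d ⟧ - ⟦ 2 ⟧ * ⟦ d ⟧ ≈ ⟦ t Nat.+ (d Nat.+ d) ⟧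
    shiftʳ = begin
      ⟦ t Nat.+ 4 Nat.* d ⟧ - ⟦ 2 ⟧ * ⟦ d ⟧
        ≈⟨ +-congʳ (trans (⟦⟧-homo-+ t (4 Nat.* d)) (+-congˡ (×1-homo-* 4 d))) ⟩
      ⟦ t ⟧ + ⟦ 4 ⟧ * ⟦ d ⟧ - ⟦ 2 ⟧ * ⟦ d ⟧
        ≈⟨ solve 2 (λ t d → t :+ con (+ 4) :* d :- con (+ 2) :* d := t :+ (d :+ d))
             refl ⟦ t ⟧ ⟦ d ⟧ ⟩
      ⟦ t ⟧ + (⟦ d ⟧ + ⟦ d ⟧)
        ≈⟨ trans (⟦⟧-homo-+ t (d Nat.+ d)) (+-congˡ (⟦⟧-homo-+ d d)) ⟨
      ⟦ t Nat.+ (d Nat.+ d) ⟧ ∎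

  module _ (G : ConnectedGraph n) where
    open ConnectedGraph G
    open Distance G

    private
      L = distanceLaplacian G
      D = distanceMatrix G

      T : Vector Carrier n
      T u = ⟦ transmission u ⟧

    distanceLaplacian-sym : ∀ u v → L u v ≈ L v u
    distanceLaplacian-sym u v =
      +-cong (diag-sym _ u v) (-‿cong (reflexive (≡.cong ⟦_⟧ (dist-sym u v))))

    ⟦transmission⟧ : ∀ u → ⟦ transmission u ⟧ ≈ sum (D u)
    ⟦transmission⟧ u = trans (⟦⟧-homo-sum (λ v → dist v u))
      (sum-cong-≋ λ v → reflexive (≡.cong ⟦_⟧ (dist-sym v u)))

    distanceLaplacian-diagonal : ∀ u → L u u ≈ ⟦ transmission u ⟧
    distanceLaplacian-diagonal u = trans
      (+-cong (reflexive (diag-≡ T u)) (-‿cong (reflexive (≡.cong ⟦_⟧ (dist-refl u)))))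
      (trans (+-congˡ -0#≈0#) (+-identityʳ _))

    distanceLaplacian-trace : (sum λ u → L u u) ≈ ⟦ 2 ⟧ * wiener G
    distanceLaplacian-trace = trans
      (sum-cong-≋ λ u → trans (distanceLaplacian-diagonal u) (⟦transmission⟧ u))
      (sym (x*[y/x]≈y (⟦suc⟧≉0 1)))

    distanceLaplacian-difference : ∀ {u v} → u ≢ v →
      difference L u v ≈ ⟦ transmission u Nat.+ transmission v Nat.+ (dist u v Nat.+ dist u v) ⟧
    distanceLaplacian-difference {u} {v} u≢v = begin
      (L u u - L u v) - (L v u - L v v)
        ≈⟨ +-cong (+-cong (distanceLaplacian-diagonal u) (-‿cong L-off))
             (-‿cong (+-cong (trans (distanceLaplacian-sym v u) L-off)
                             (-‿cong (distanceLaplacian-diagonal v)))) ⟩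
      (⟦ transmission u ⟧ - (0# - ⟦ dist u v ⟧)) - ((0# - ⟦ dist u v ⟧) - ⟦ transmission v ⟧)
        ≈⟨ solve 3 (λ s t d → (s :- (con (+ 0) :- d)) :- ((con (+ 0) :- d) :- t) := s :+ t :+ (d :+ d)) refl
             ⟦ transmission u ⟧ ⟦ transmission v ⟧ ⟦ dist u v ⟧ ⟩
      ⟦ transmission u ⟧ + ⟦ transmission v ⟧ + (⟦ dist u v ⟧ + ⟦ dist u v ⟧)
        ≈⟨ +-cong (⟦⟧-homo-+ (transmission u) (transmission v)) (⟦⟧-homo-+ (dist u v) (dist u v)) ⟨
      ⟦ transmission u Nat.+ transmission v ⟧ + ⟦ dist u v Nat.+ dist u v ⟧
        ≈⟨ ⟦⟧-homo-+ (transmission u Nat.+ transmission v) (dist u v Nat.+ dist u v) ⟨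
      ⟦ transmission u Nat.+ transmission v Nat.+ (dist u v Nat.+ dist u v) ⟧ ∎
      where
      open ≈-Reasoning
      L-off : L u v ≈ 0# - ⟦ dist u v ⟧
      L-off = +-congʳ (reflexive (diag-≢ T u≢v))

    -- The form is the double sum of d(u,v) x(u) (x(u) - x(v)); adding the term with u and v
    -- exchanged completes the square d(u,v) (x(u) - x(v))².
    distanceLaplacian-positive : ∀ x → 0# ≤ x · λ u → L u · x
    distanceLaplacian-positive x = ≤-resp-≈ refl (sym (sum-cong-≋ row))
      (double-sum-nonNeg f λ u v → ≤-resp-≈ refl
        (trans
          (solve 3 (λ d x y →
              d :* ((x :- y) :* (x :- y)) := d :* (x :* (x :- y)) :+ d :* (y :* (y :- x)))
               refl (D u v) (x u) (x v))
          (+-congˡ (*-congʳ (reflexive (≡.cong ⟦_⟧ (dist-sym u v))))))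
        (*-nonNeg (⟦⟧-nonNeg (dist u v)) (square-nonNeg (x u - x v))))
      where
      open ≈-Reasoning
      f : Fin n → Fin n → Carrier
      f u v = D u v * (x u * (x u - x v))
      row : ∀ u → x u * (L u · x) ≈ sum (f u)
      row u = begin
        x u * (L u · x)
          ≈⟨ *-congˡ (sum-cong-≋ λ v → solve 3 (λ t d x → (t :- d) :* x := t :* x :- d :* x)
               refl (diag T u v) (D u v) (x v)) ⟩
        x u * (sum λ v → diag T u v * x v - D u v * x v)
          ≈⟨ *-congˡ (sum-sub (λ v → diag T u v * x v) (λ v → D u v * x v)) ⟩
        x u * (diag T u · x - D u · x)
          ≈⟨ *-congˡ (+-congʳ (trans (diag-· T x u)
               (trans (*-congʳ (⟦transmission⟧ u)) (*-distribʳ-sum (x u) (D u))))) ⟩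
        x u * ((sum λ v → D u v * x u) - D u · x)
          ≈⟨ *-congˡ (sum-sub (λ v → D u v * x u) (λ v → D u v * x v)) ⟨
        (x u * sum λ v → D u v * x u - D u v * x v)
          ≈⟨ *-distribˡ-sum (x u) (λ v → D u v * x u - D u v * x v) ⟩
        (sum λ v → x u * (D u v * x u - D u v * x v))
          ≈⟨ (sum-cong-≋ λ v → solve 3 (λ d x y → x :* (d :* x :- d :* y) := d :* (x :* (x :- y)))
               refl (D u v) (x u) (x v)) ⟩
        sum (f u) ∎

    largest-eigenvalue-bound : ∀ {θ τ} → Eigenvalues L θ → (∀ i → θ i ≤ τ) →
      ∀ {u v d} → u ≢ v → dist u v ≡ d →
      ⟦ 2 ⟧ * ⟦ n ⟧ + ⟦ d ⟧ * ⟦ d ⟧ - ⟦ 2 ⟧ * ⟦ d ⟧ + 1# ≤ ⟦ 2 ⟧ * τ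
    largest-eigenvalue-bound {τ = τ} θ-eigenvalues θ≤τ {u} {v} u≢v ≡.refl =
      cast-bound n (dist u v) (transmission u Nat.+ transmission v) (⟦ 2 ⟧ * τ) (transmission-bound u≢v)
        (≤-resp-≈ (distanceLaplacian-difference u≢v)
          (trans (*-congˡ (difference-δ u≢v)) (*-comm _ _))
          (EigenvalueBounds.difference-≤ distanceLaplacian-sym θ-eigenvalues θ≤τ u v))

theorem4p2 : ∀ {c ℓ₁ ℓ₂} (F : OrderedField c ℓ₁ ℓ₂) →
    let open OrderedField F
        open DistanceLaplacian F in
    ∀ {n : ℕ} (2≤n : 2 Nat.≤ n) (G : ConnectedGraph n) →
    let d = ConnectedGraph.diameter G in
    (∂ : Vector Carrier n) → Eigenvalues (distanceLaplacian G) ∂ →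
    (⟦ 2 ⟧ * ⟦ n ⟧ + ⟦ d ⟧ * ⟦ d ⟧ - ⟦ 2 ⟧ * ⟦ d ⟧ + 1#) / ⟦ 2 ⟧
      - (⟦ 2 ⟧ * wiener G) / (⟦ n ⟧ - 1#)
    ≤ spread 2≤n ∂
theorem4p2 F {n} (Nat.s≤s (Nat.s≤s {n = m} Nat.z≤n)) G ∂ ∂-eigenvalues =
  -- With `n` matched as `suc (suc m)`, `spread` reduces to `∂ zero - ∂ (inject₁ (fromℕ m))`; the
  -- upper bound on the second entry is used negated.
  +-mono-≤ (x≤z*y⇒x/z≤y (⟦suc⟧≉0 1) (⟦⟧-nonNeg 2) ∂₁-bound)
           (neg-mono-≤ (z*y≤x⇒y≤x/z (⟦suc⟧≉0 m ∘ trans (sym n-1≈))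
                                    (≤-resp-≈ refl (sym n-1≈) (⟦⟧-nonNeg (suc m)))
                                    ∂ₙ₋₁-bound))
  where
  open OrderedFieldProperties F
  open DistanceLaplacian F
  open SpectralTheory F
  open DistanceLaplacianProperties F
  open ConnectedGraph G
  open Eigenvalues ∂-eigenvalues
  open EigenvalueBounds (distanceLaplacian-sym G) ∂-eigenvalues
  open ≤-Reasoning

  d = diameter

  n-1≈ : ⟦ n ⟧ - 1# ≈ ⟦ suc m ⟧
  -- `⟦ n ⟧` unfolds to `1# + ⟦ suc m ⟧`.
  n-1≈ = solve 2 (λ x y → x :+ y :- x := y) refl 1# ⟦ suc m ⟧

  ∂ₙ₋₁-bound : (⟦ n ⟧ - 1#) * ∂ (inject₁ (fromℕ m)) ≤ ⟦ 2 ⟧ * wiener G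
  ∂ₙ₋₁-bound = begin
    (⟦ n ⟧ - 1#) * ∂ (inject₁ (fromℕ m))   ≈⟨ *-congʳ n-1≈ ⟩
    ⟦ suc m ⟧ * ∂ (inject₁ (fromℕ m))
      ≤⟨ penultimate-≤ decreasing (eigenvalue-nonNeg (distanceLaplacian-positive G)) ⟩
    sum ∂                                  ≈⟨ trace≈sum ⟨
    (sum λ u → distanceLaplacian G u u)    ≈⟨ distanceLaplacian-trace G ⟩
    ⟦ 2 ⟧ * wiener G                       ∎

  ∂₁-bound : ⟦ 2 ⟧ * ⟦ n ⟧ + ⟦ d ⟧ * ⟦ d ⟧ - ⟦ 2 ⟧ * ⟦ d ⟧ + 1# ≤ ⟦ 2 ⟧ * ∂ zero
  ∂₁-bound =
    let u , v , u≢v , duv≡d = diametralPair G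
    in  largest-eigenvalue-bound G ∂-eigenvalues (λ i → decreasing zero i Nat.z≤n) u≢v duv≡d
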